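{- Let $g\geq 1$ be an integer, let $\varepsilon\in\{1,-1\}$, and let $p=6g+\varepsilon$. Let $i$ be an integer with $0\leq i\leq p-1$ such that \[ i\not\equiv \frac{p^2-1}{12}\pmod p \] and \[ i\not\equiv (k-g)(3k-3g-\varepsilon)\pmod p\qquad\text{for every integer } k \text{ with } 1\leq k\leq \frac{p-1}{2}. \] Then for all integers $n\geq 0$, \[ \mathcal{EO}_u(2pn+2i)\equiv 0\pmod 2. \]
   Context: For a positive integer $k$, let $f_k:=(q^k;q^k)_\infty=\prod_{i=1}^\infty(1-q^{ki})$. The integers $\mathcal{EO}_u(n)$, $n\ge 0$, are defined by $\sum_{n=0}^\infty \mathcal{EO}_u(n)q^n=\dfrac{f_4^2}{f_2^2}$. The integer $p$ is not assumed to be prime. -}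

module Defs where

open import Data.Fin.Base using (toℕ; inject₁; fromℕ)
open import Data.Fin.Properties using (toℕ<n; toℕ-inject₁; toℕ-fromℕ)
open import Data.Integer.Base using (ℤ; _+_; _*_; _-_; -_; 0ℤ; 1ℤ)
import Data.Integer.Properties as ℤ
open import Data.Integer.Divisibility.Signed using (_∣_)
open import Data.Nat.Base as ℕ using (ℕ; zero; suc; z≤n; s≤s; _∸_; NonZero)
import Data.Nat.Properties as ℕ
open import Data.Nat.Induction using (<-rec; <-wellFounded)
open import Function.Base using (_∘_)
open import Induction.WellFounded using (WfRec; module FixPoint)
open import Relation.Binary.PropositionalEquality
  using (_≡_; _≗_; refl; trans; cong; cong₂; module ≡-Reasoning)
open import Relation.Nullary.Decidable using (yes; no)
open import Relation.Nullary.Negation using (contradiction)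

open import Algebra.Properties.Semiring.Sum ℤ.+-*-semiring public
  using (sum-cong-≗; sum-init-last; sum-syntax; sum⁺-syntax)

infix 4 _≡_[mod_]

_≡_[mod_] : ℤ → ℤ → ℤ → Set
a ≡ b [mod m ] = m ∣ a - b

-- A formal power series in q over ℤ is its sequence of coefficients;
-- series are compared by pointwise equality.
PowerSeries : Set
PowerSeries = ℕ → ℤ

infixl 6 _⊝_
infixl 7 _·_ _÷_
infixr 8 _²

q^_ : ℕ → PowerSeries
(q^ m) n with m ℕ.≟ n
... | yes _ = 1ℤ
... | no  _ = 0ℤ

_⊝_ : PowerSeries → PowerSeries → PowerSeries
(a ⊝ b) n = a n - b n

_·_ : PowerSeries → PowerSeries → PowerSeries
(a · b) n = ∑[ j ≤ n ] (a (toℕ j) * b (n ∸ toℕ j))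

_² : PowerSeries → PowerSeries
a ² = a · a

-- The quotient by a series with constant coefficient 1 (see ÷-·), obtained
-- by solving c · b ≗ a for the coefficients of c in turn.  For any other
-- constant coefficient the value is meaningless.
÷-step : PowerSeries → PowerSeries → ∀ n → WfRec ℕ._<_ (λ _ → ℤ) n → ℤ
÷-step a b n c = a n - ∑[ j < n ] (c (toℕ<n j) * b (n ∸ toℕ j))

_÷_ : PowerSeries → PowerSeries → PowerSeries
a ÷ b = <-rec (λ _ → ℤ) (÷-step a b)

-- qProduct k N is the partial product ∏_{1 ≤ i ≤ N} (1 - q^{ki}).
qProduct : ℕ → ℕ → PowerSeries
qProduct k zero    = q^ 0
qProduct k (suc N) = qProduct k N · (q^ 0 ⊝ q^ (k ℕ.* suc N))

-- The infinite product (q^k; q^k)_∞ for k ≥ 1.  Its n-th coefficient is read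
-- off the n-th partial product, since the remaining factors do not change it
-- (see qProduct-stable).
f : ℕ → PowerSeries
f k n = qProduct k n n

EOᵤ : PowerSeries
EOᵤ = f 4 ² ÷ f 2 ²

÷-unfold : ∀ a b n → (a ÷ b) n ≡ a n - ∑[ j < n ] ((a ÷ b) (toℕ j) * b (n ∸ toℕ j))
÷-unfold a b n = FixPoint.unfold-wfRec <-wellFounded (λ _ → ℤ) (÷-step a b) ext {n}
  where
  ext : ∀ m {c c′ : WfRec ℕ._<_ (λ _ → ℤ) m} →
        (∀ {y} (y<m : y ℕ.< m) → c y<m ≡ c′ y<m) → ÷-step a b m c ≡ ÷-step a b m c′
  ext m c≡c′ = cong (λ s → a m - s)
    (sum-cong-≗ λ j → cong (_* b (m ∸ toℕ j)) (c≡c′ (toℕ<n j)))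

÷-· : ∀ a b → b 0 ≡ 1ℤ → (a ÷ b) · b ≗ a
÷-· a b b₀≡1 n = begin
  ∑[ j ≤ n ] t j
    ≡⟨ sum-init-last t ⟩
  ∑[ j < n ] t (inject₁ j) + t (fromℕ n)
    ≡⟨ cong₂ _+_ (sum-cong-≗ {n} λ j → cong term (toℕ-inject₁ j)) (cong term (toℕ-fromℕ n)) ⟩
  s + c n * b (n ∸ n)
    ≡⟨ cong (λ m → s + c n * b m) (ℕ.n∸n≡0 n) ⟩
  s + c n * b 0
    ≡⟨ cong (λ x → s + c n * x) b₀≡1 ⟩
  s + c n * 1ℤ
    ≡⟨ cong (s +_) (ℤ.*-identityʳ (c n)) ⟩
  s + c n
    ≡⟨ cong (s +_) (÷-unfold a b n) ⟩
  s + (a n - s)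
    ≡⟨ ℤ.+-comm s (a n - s) ⟩
  a n - s + s
    ≡⟨ ℤ.+-assoc (a n) (- s) s ⟩
  a n + (- s + s)
    ≡⟨ cong (a n +_) (ℤ.+-inverseˡ s) ⟩
  a n + 0ℤ
    ≡⟨ ℤ.+-identityʳ (a n) ⟩
  a n ∎
  where
  open ≡-Reasoning
  c    = a ÷ b
  term = λ j → c j * b (n ∸ j)
  t    = λ j → term (toℕ j)
  s    = ∑[ j < n ] term (toℕ j)

·-truncate : ∀ a b n → b 0 ≡ 1ℤ → (∀ m → 1 ℕ.≤ m → m ℕ.≤ n → b m ≡ 0ℤ) → (a · b) n ≡ a n
·-truncate a b zero b₀≡1 _ =
  trans (ℤ.+-identityʳ _) (trans (cong (a 0 *_) b₀≡1) (ℤ.*-identityʳ (a 0)))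
·-truncate a b (suc n) b₀≡1 b≡0 = trans
  (cong₂ _+_
    (trans (cong (a 0 *_) (b≡0 (suc n) (s≤s z≤n) ℕ.≤-refl)) (ℤ.*-zeroʳ (a 0)))
    (·-truncate (a ∘ suc) b n b₀≡1 λ m 1≤m m≤n → b≡0 m 1≤m (ℕ.m≤n⇒m≤1+n m≤n)))
  (ℤ.+-identityˡ (a (suc n)))

q^-off : ∀ {m n} → n ℕ.< m → (q^ m) n ≡ 0ℤ
q^-off {m} {n} n<m with m ℕ.≟ n
... | yes refl = contradiction n<m (ℕ.<-irrefl refl)
... | no  _    = refl

qProduct-step : ∀ k .{{_ : NonZero k}} {n N} → n ℕ.≤ N → qProduct k (suc N) n ≡ qProduct k N n
qProduct-step k {n} {N} n≤N = ·-truncate (qProduct k N) (q^ 0 ⊝ q^ e) n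
  (cong (λ x → 1ℤ - x) (q^-off (ℕ.≤-trans (s≤s z≤n) N<e)))
  λ { (suc m) _ m<n → cong (λ x → 0ℤ - x) (q^-off (ℕ.≤-trans (s≤s (ℕ.≤-trans m<n n≤N)) N<e)) }
  where
  e = k ℕ.* suc N
  N<e : suc N ℕ.≤ e
  N<e = ℕ.m≤n*m (suc N) k

qProduct-stable : ∀ k .{{_ : NonZero k}} n d → qProduct k (d ℕ.+ n) n ≡ f k n
qProduct-stable k n zero    = refl
qProduct-stable k n (suc d) =
  trans (qProduct-step k (ℕ.m≤n+m n d)) (qProduct-stable k n d)

EOᵤ-spec : EOᵤ · f 2 ² ≗ f 4 ²
EOᵤ-spec = ÷-· (f 4 ²) (f 2 ²) refl

{-# OPTIONS --safe #-}

-- Modulo 2, f₂² ≡ f₄, so EOᵤ ≡ f₄² / f₄ = f₄.  By Euler's pentagonal number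
-- theorem in the variable q⁴, the coefficient of f₄ at 2N vanishes unless
-- N = m(3m - 1) for some integer m.  For N = pn + i that equation would give
-- i ≡ φ(k) (mod p) with k = εm + g and φ(k) = (k - g)(3k - 3g - ε).  Since
-- φ(k) - φ(l) = (k - l)(3(k + l) - p), the value of φ modulo p depends only on
-- ±k modulo p, so one may take 0 ≤ k ≤ (p - 1)/2, and φ(0) = (p² - 1)/12: every
-- case is excluded by hypothesis.

module Submission where

open import Defs
open import Data.Integer
  using (ℤ; +_; -[1+_]; _+_; _*_; _-_; -_; _^_; _/_; _≤_; 0ℤ; 1ℤ; -1ℤ; ∣_∣; +≤+)
open import Data.Integer.DivMod using (_/ℕ_; _%ℕ_; a≡a%ℕn+[a/ℕn]*n; n%ℕd<d; div-pos-is-/ℕ)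
open import Data.Integer.Divisibility.Signed
  using (_∣_; divides; ∣-refl; ∣-reflexive; ∣m⇒∣m*n; ∣n⇒∣m*n; ∣m∣n⇒∣m+n; ∣m∣n⇒∣m-n)
import Data.Integer.Properties as ℤ
open import Data.Integer.Tactic.RingSolver using (solve-∀)
open import Data.Nat as ℕ using (ℕ; zero; suc; z≤n; s≤s; _∸_)
import Data.Nat.Properties as ℕ
open import Data.Nat.Tactic.RingSolver using () renaming (solve-∀ to solveℕ-∀)
open import Data.Fin.Base using (toℕ)
open import Data.Fin.Properties using (toℕ≤pred[n])
import Data.Maybe.Base as Maybe
open import Data.Product using (∃; _×_; _,_; proj₁; proj₂)
open import Data.Sum using (_⊎_; inj₁; inj₂)
open import Function.Base using (_∘_)
open import Level using (0ℓ)
open import Algebra.Bundles using (CommutativeRing)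
open import Algebra.Construct.Pointwise ℕ using (isAbelianGroup)
import Algebra.Solver.Ring as RingSolver
open import Algebra.Solver.Ring.AlmostCommutativeRing
  using (fromCommutativeRing; _-Raw-AlmostCommutative⟶_)
import Relation.Binary.Reasoning.Setoid as SetoidReasoning
open import Relation.Binary.PropositionalEquality
  using (_≡_; _≢_; _≗_; refl; sym; trans; cong; cong₂; subst; module ≡-Reasoning)
open import Relation.Nullary using (¬_; contradiction)
open import Relation.Nullary.Decidable using (yes; no; dec⇒maybe)

-- The commutative ring of formal power series.

infixl 6 _⊕_
infix 8 ⊖_

_⊕_ : PowerSeries → PowerSeries → PowerSeries
(a ⊕ b) n = a n + b n

⊖_ : PowerSeries → PowerSeries
(⊖ a) n = - a n

-- The clause for 1ℤ makes the solver's constant con 1ℤ convertible to q^ 0.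
const : ℤ → PowerSeries
const (+ 1) = q^ 0
const c zero    = c
const c (suc n) = 0ℤ

const-zero : ∀ c → const c 0 ≡ c
const-zero (+ 0)             = refl
const-zero (+ 1)             = refl
const-zero (+ suc (suc _))   = refl
const-zero (-[1+ _ ])        = refl

const-suc : ∀ c n → const c (suc n) ≡ 0ℤ
const-suc (+ 0)           n = refl
const-suc (+ 1)           n = refl
const-suc (+ suc (suc _)) n = refl
const-suc (-[1+ _ ])      n = refl

-- Coefficient `n` of a product sees its factors only up to `n`; that is the range in which `f k`
-- can be replaced by a partial product.
·-cong-≤ : ∀ {a a′ b b′ : PowerSeries} n → (∀ m → m ℕ.≤ n → a m ≡ a′ m) →
           (∀ m → m ℕ.≤ n → b m ≡ b′ m) → (a · b) n ≡ (a′ · b′) n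
·-cong-≤ n a≡a′ b≡b′ = sum-cong-≗ {suc n} λ j →
  cong₂ _*_ (a≡a′ (toℕ j) (toℕ≤pred[n] j)) (b≡b′ (n ∸ toℕ j) (ℕ.m∸n≤m n (toℕ j)))

·-cong : ∀ {a a′ b b′} → a ≗ a′ → b ≗ b′ → a · b ≗ a′ · b′
·-cong a≗a′ b≗b′ n = ·-cong-≤ n (λ m _ → a≗a′ m) (λ m _ → b≗b′ m)

·-zeroˡ-≤ : ∀ {a} b n → (∀ m → m ℕ.≤ n → a m ≡ 0ℤ) → (a · b) n ≡ 0ℤ
·-zeroˡ-≤ b zero    a≡0 rewrite a≡0 0 z≤n = refl
·-zeroˡ-≤ b (suc n) a≡0 rewrite a≡0 0 z≤n =
  trans (ℤ.+-identityˡ _) (·-zeroˡ-≤ b n λ m m≤n → a≡0 (suc m) (s≤s m≤n))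

·-identityˡ : ∀ a → q^ 0 · a ≗ a
·-identityˡ a zero    = lemma (a 0)
  where
  lemma : ∀ x → 1ℤ * x + 0ℤ ≡ x
  lemma = solve-∀
·-identityˡ a (suc n) = trans
  (cong (λ s → 1ℤ * a (suc n) + s) (·-zeroˡ-≤ a n λ _ _ → refl))
  (trans (ℤ.+-identityʳ _) (ℤ.*-identityˡ _))

·-distribʳ-⊕ : ∀ c a b → (a ⊕ b) · c ≗ a · c ⊕ b · c
·-distribʳ-⊕ c a b zero    = lemma (a 0) (b 0) (c 0)
  where
  lemma : ∀ x y z → (x + y) * z + 0ℤ ≡ (x * z + 0ℤ) + (y * z + 0ℤ)
  lemma = solve-∀
·-distribʳ-⊕ c a b (suc n) = trans
  (cong (λ s → (a 0 + b 0) * c (suc n) + s) (·-distribʳ-⊕ c (a ∘ suc) (b ∘ suc) n))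
  (lemma (a 0) (b 0) (c (suc n)) _ _)
  where
  lemma : ∀ x y z u v → (x + y) * z + (u + v) ≡ (x * z + u) + (y * z + v)
  lemma = solve-∀

·-scaleˡ : ∀ x a b n → ((λ m → x * a m) · b) n ≡ x * (a · b) n
·-scaleˡ x a b zero    = lemma x (a 0) (b 0)
  where
  lemma : ∀ x y z → x * y * z + 0ℤ ≡ x * (y * z + 0ℤ)
  lemma = solve-∀
·-scaleˡ x a b (suc n) = trans
  (cong (λ s → x * a 0 * b (suc n) + s) (·-scaleˡ x (a ∘ suc) b n))
  (lemma x (a 0) (b (suc n)) _)
  where
  lemma : ∀ x y z u → x * y * z + x * u ≡ x * (y * z + u)
  lemma = solve-∀

·-assoc : ∀ a b c → (a · b) · c ≗ a · (b · c)
·-assoc a b c zero    = lemma (a 0) (b 0) (c 0)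
  where
  lemma : ∀ x y z → (x * y + 0ℤ) * z + 0ℤ ≡ x * (y * z + 0ℤ) + 0ℤ
  lemma = solve-∀
·-assoc a b c (suc n) = begin
  -- By computation, `a · b` shifted by one is a multiple of the shifted `b` plus `(a ∘ suc) · b`,
  -- so the induction is on the shift of `a`.
  (a 0 * b 0 + 0ℤ) * c (suc n) + (((λ m → a 0 * b (suc m)) ⊕ (a ∘ suc) · b) · c) n
    ≡⟨ cong (λ s → (a 0 * b 0 + 0ℤ) * c (suc n) + s)
         (·-distribʳ-⊕ c (λ m → a 0 * b (suc m)) ((a ∘ suc) · b) n) ⟩
  (a 0 * b 0 + 0ℤ) * c (suc n) + (((λ m → a 0 * b (suc m)) · c) n + ((a ∘ suc) · b · c) n)
    ≡⟨ cong (λ s → (a 0 * b 0 + 0ℤ) * c (suc n) + s)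
         (cong₂ _+_ (·-scaleˡ (a 0) (b ∘ suc) c n) (·-assoc (a ∘ suc) b c n)) ⟩
  (a 0 * b 0 + 0ℤ) * c (suc n) + (a 0 * ((b ∘ suc) · c) n + ((a ∘ suc) · (b · c)) n)
    ≡⟨ lemma (a 0) (b 0) (c (suc n)) _ _ ⟩
  (a · (b · c)) (suc n) ∎
  where
  open ≡-Reasoning
  lemma : ∀ x y z u v → (x * y + 0ℤ) * z + (x * u + v) ≡ x * (y * z + u) + v
  lemma = solve-∀

-- The convolution unfolds at its first summand, where `a` has index 0. Splitting off the other end,
-- where `b` has index 0, is what lets commutativity go by induction.
·-suc : ∀ a b n → (a · b) (suc n) ≡ b 0 * a (suc n) + (a · (b ∘ suc)) n
·-suc a b zero    = lemma (a 0) (b 1) (a 1) (b 0)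
  where
  lemma : ∀ x y z u → x * y + (z * u + 0ℤ) ≡ u * z + (x * y + 0ℤ)
  lemma = solve-∀
·-suc a b (suc n) = trans
  (cong (λ s → a 0 * b (suc (suc n)) + s) (·-suc (a ∘ suc) b n))
  (lemma (a 0 * b (suc (suc n))) (b 0 * a (suc (suc n))) _)
  where
  lemma : ∀ x y z → x + (y + z) ≡ y + (x + z)
  lemma = solve-∀

·-comm : ∀ a b → a · b ≗ b · a
·-comm a b zero    = cong (_+ 0ℤ) (ℤ.*-comm (a 0) (b 0))
·-comm a b (suc n) = trans (·-suc a b n) (cong (λ s → b 0 * a (suc n) + s) (·-comm a (b ∘ suc) n))

powerSeriesRing : CommutativeRing 0ℓ 0ℓ
powerSeriesRing = record
  { Carrier = PowerSeries
  ; _≈_ = _≗_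
  ; _+_ = _⊕_
  ; _*_ = _·_
  ; -_  = ⊖_
  ; 0#  = λ _ → 0ℤ
  ; 1#  = q^ 0
  ; isCommutativeRing = record
    { isRing = record
      { +-isAbelianGroup = isAbelianGroup ℤ.+-0-isAbelianGroup
      ; *-cong = ·-cong
      ; *-assoc = ·-assoc
      ; *-identity = ·-identityˡ , λ a n → trans (·-comm a (q^ 0) n) (·-identityˡ a n)
      ; distrib = (λ c a b n → trans (·-comm c (a ⊕ b) n) (trans (·-distribʳ-⊕ c a b n)
                    (cong₂ _+_ (·-comm a c n) (·-comm b c n))))
                , ·-distribʳ-⊕
      }
    ; *-comm = ·-comm
    }
  }

module PS = CommutativeRing powerSeriesRing

const-* : ∀ x y → const (x * y) ≗ const x · const y
const-* x y zero rewrite const-zero (x * y) | const-zero x | const-zero y = sym (ℤ.+-identityʳ _)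
const-* x y (suc n) rewrite const-suc (x * y) n | const-suc y n = sym (trans
  (cong₂ _+_ (ℤ.*-zeroʳ (const x 0)) (·-zeroˡ-≤ (const y) n λ m _ → const-suc x m))
  (ℤ.+-identityˡ 0ℤ))

-- Integer coefficients give the ring solver a decidable equality, which power series do not have.
const-morphism : CommutativeRing.rawRing ℤ.+-*-commutativeRing
                 -Raw-AlmostCommutative⟶ fromCommutativeRing powerSeriesRing
const-morphism = record
  { ⟦_⟧    = const
  ; +-homo = λ x y → λ where
      zero    → trans (const-zero (x + y)) (sym (cong₂ _+_ (const-zero x) (const-zero y)))
      (suc n) → trans (const-suc (x + y) n) (sym (cong₂ _+_ (const-suc x n) (const-suc y n)))
  ; *-homo = const-*
  ; -‿homo = λ x → λ where
      zero    → trans (const-zero (- x)) (sym (cong -_ (const-zero x)))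
      (suc n) → trans (const-suc (- x) n) (sym (cong -_ (const-suc x n)))
  ; 0-homo = λ { zero → refl ; (suc n) → refl }
  ; 1-homo = λ _ → refl
  }

open RingSolver (CommutativeRing.rawRing ℤ.+-*-commutativeRing)
  (fromCommutativeRing powerSeriesRing) const-morphism
  (λ x y → Maybe.map (λ x≡y n → cong (λ z → const z n) x≡y) (dec⇒maybe (x ℤ.≟ y)))
  using (solve; _:=_; _:+_; _:*_; _:-_; :-_; con)

-- Powers of q.

q^-suc : ∀ m n → (q^ suc m) (suc n) ≡ (q^ m) n
q^-suc m n with m ℕ.≟ n | suc m ℕ.≟ suc n
... | yes _    | yes _   = refl
... | no _     | no _    = refl
... | yes refl | no m≢m   = contradiction refl m≢m
... | no m≢n   | yes refl = contradiction refl m≢n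

q^-≢ : ∀ {m n} → m ≢ n → (q^ m) n ≡ 0ℤ
q^-≢ {m} {n} m≢n with m ℕ.≟ n
... | yes m≡n = contradiction m≡n m≢n
... | no _    = refl

q^-+ : ∀ m n → q^ (m ℕ.+ n) ≗ q^ m · q^ n
q^-+ zero    n k       = sym (·-identityˡ (q^ n) k)
q^-+ (suc m) n zero    = refl
q^-+ (suc m) n (suc k) = begin
  (q^ suc (m ℕ.+ n)) (suc k)     ≡⟨ q^-suc (m ℕ.+ n) k ⟩
  (q^ (m ℕ.+ n)) k               ≡⟨ q^-+ m n k ⟩
  (q^ m · q^ n) k                ≡⟨ ·-cong {b = q^ n} (q^-suc m) (λ _ → refl) k ⟨
  (((q^ suc m) ∘ suc) · q^ n) k  ≡⟨ ℤ.+-identityˡ _ ⟨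
  (q^ suc m · q^ n) (suc k)      ∎
  where open ≡-Reasoning

·-q^-off : ∀ a {m n} → n ℕ.< m → (a · q^ m) n ≡ 0ℤ
·-q^-off a {m} {n} n<m = trans (·-comm a (q^ m) n)
  (·-zeroˡ-≤ a n λ j j≤n → q^-off (ℕ.≤-<-trans j≤n n<m))

-- The pentagonal number theorem.

triangular : ℕ → ℕ
triangular zero    = 0
triangular (suc n) = triangular n ℕ.+ suc n

private module Exponents where

  -- Exponent bookkeeping: `rise` and `split` compare the exponents of `gap s d` and `gap r (suc d)`
  -- with those of `term s (suc d)` and `term (suc r) (suc d)`; `same` says that `gap r (suc d)` and
  -- `term (suc r) d` share their exponent.
  rise : ∀ k s d τ → k ℕ.* (suc s ℕ.* suc (s ℕ.+ d) ℕ.+ τ) ≡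
         k ℕ.* (s ℕ.+ suc d) ℕ.+ k ℕ.* (s ℕ.* (s ℕ.+ suc d) ℕ.+ τ)
  rise = solveℕ-∀

  split : ∀ k r d τ → k ℕ.* (suc r ℕ.* (suc r ℕ.+ suc d) ℕ.+ (τ ℕ.+ suc r)) ≡
          k ℕ.* suc r ℕ.+ k ℕ.* (suc r ℕ.* suc (r ℕ.+ suc d) ℕ.+ τ)
  split = solveℕ-∀

  same : ∀ k r d τ → k ℕ.* (suc r ℕ.* (suc r ℕ.+ d) ℕ.+ (τ ℕ.+ suc r)) ≡
         k ℕ.* (suc r ℕ.* suc (r ℕ.+ suc d) ℕ.+ τ)
  same = solveℕ-∀

  -- Each term with s ≥ 1 starts beyond degree n = s + d, so it is invisible in the coefficients up
  -- to n.
  large : ∀ m d → suc m ℕ.+ d ℕ.< suc m ℕ.* (suc m ℕ.+ d) ℕ.+ triangular (suc m)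
  large m d = begin
    1 ℕ.+ (suc m ℕ.+ d)                                 ≡⟨ ℕ.+-comm 1 (suc m ℕ.+ d) ⟩
    suc m ℕ.+ d ℕ.+ 1                                   ≤⟨ ℕ.+-mono-≤ (ℕ.m≤n*m (suc m ℕ.+ d) (suc m)) 1≤ ⟩
    suc m ℕ.* (suc m ℕ.+ d) ℕ.+ triangular (suc m)      ∎
    where
    open ℕ.≤-Reasoning
    1≤ : 1 ℕ.≤ triangular (suc m)
    1≤ = ℕ.≤-trans (s≤s z≤n) (ℕ.m≤n+m (suc m) (triangular m))

-- Shanks' finite form of the pentagonal number theorem, in the variable
-- x = q^k.  With n = s + d, the polynomials
--   term s d = ∏_{s < j ≤ n} (1 - x^j) x^{sn + s(s+1)/2}
-- satisfy ∑_{0 ≤ s ≤ n} (-1)^s term s (n - s) = ∑_{-n ≤ s ≤ n} (-1)^s x^{s(3s+1)/2},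
-- because raising n by one changes the sum by a telescoping amount; the terms
-- with s ≥ 1 do not affect coefficients up to x^n, and term 0 n is the partial
-- product itself.
module Shanks (k : ℕ) where

  open SetoidReasoning PS.setoid

  factor : ℕ → PowerSeries
  factor m = q^ 0 ⊝ q^ (k ℕ.* m)

  tailProduct : ℕ → ℕ → PowerSeries
  tailProduct s zero    = q^ 0
  tailProduct s (suc d) = tailProduct s d · factor (s ℕ.+ suc d)

  tailProduct-0 : ∀ d → tailProduct 0 d ≡ qProduct k d
  tailProduct-0 zero    = refl
  tailProduct-0 (suc d) = cong (_· factor (suc d)) (tailProduct-0 d)

  -- The recursion appends the last factor; splitting off the first one instead relates `gap r` to
  -- the product in `term (suc r)`.
  tailProduct-front : ∀ s d → tailProduct s (suc d) ≗ factor (suc s) · tailProduct (suc s) d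
  tailProduct-front s zero    = begin
    q^ 0 · factor (s ℕ.+ 1)  ≡⟨ cong (λ m → q^ 0 · factor m) (ℕ.+-comm s 1) ⟩
    q^ 0 · factor (suc s)    ≈⟨ ·-comm (q^ 0) (factor (suc s)) ⟩
    factor (suc s) · q^ 0    ∎
  tailProduct-front s (suc d) = begin
    tailProduct s (suc d) · factor (s ℕ.+ suc (suc d))
      ≡⟨ cong (λ m → tailProduct s (suc d) · factor m) (ℕ.+-suc s (suc d)) ⟩
    tailProduct s (suc d) · factor (suc s ℕ.+ suc d)
      ≈⟨ PS.*-congʳ {factor (suc s ℕ.+ suc d)} (tailProduct-front s d) ⟩
    factor (suc s) · tailProduct (suc s) d · factor (suc s ℕ.+ suc d)
      ≈⟨ ·-assoc (factor (suc s)) (tailProduct (suc s) d) _ ⟩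
    factor (suc s) · tailProduct (suc s) (suc d) ∎

  term : ℕ → ℕ → PowerSeries
  term s d = tailProduct s d · q^ (k ℕ.* (s ℕ.* (s ℕ.+ d) ℕ.+ triangular s))

  -- The telescoping quantity: passing from n to n + 1 lowers term s by
  -- gap s + gap (s - 1).
  gap : ℕ → ℕ → PowerSeries
  gap r d = tailProduct r d · q^ (k ℕ.* (suc r ℕ.* suc (r ℕ.+ d) ℕ.+ triangular r))

  gap-rise : ∀ s d → gap s d ≗ tailProduct s d ·
             (q^ (k ℕ.* (s ℕ.+ suc d)) · q^ (k ℕ.* (s ℕ.* (s ℕ.+ suc d) ℕ.+ triangular s)))
  gap-rise s d = PS.*-congˡ {tailProduct s d} (PS.trans
    (PS.reflexive (cong q^_ (Exponents.rise k s d (triangular s))))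
    (q^-+ (k ℕ.* (s ℕ.+ suc d)) _))

  term-step-0 : ∀ d → term 0 (suc d) ⊕ gap 0 d ≗ term 0 d
  term-step-0 d = begin
    term 0 (suc d) ⊕ gap 0 d                    ≈⟨ PS.+-congˡ {term 0 (suc d)} (gap-rise 0 d) ⟩
    Q · (q^ 0 ⊝ y) · e ⊕ Q · (y · e)            ≈⟨ identity Q y e ⟩
    Q · e                                       ∎
    where
    Q = tailProduct 0 d
    y = q^ (k ℕ.* suc d)
    e = q^ (k ℕ.* 0)
    identity : ∀ Q y e → Q · (q^ 0 ⊝ y) · e ⊕ Q · (y · e) ≗ Q · e
    identity = solve 3 (λ Q y e → Q :* (con 1ℤ :- y) :* e :+ Q :* (y :* e) := Q :* e) (λ _ → refl)

  -- With y = x^(n+1) from the new last factor and z = x^s from the raised exponent, the claim is (1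
  -- - y)z + yz + (1 - z) = 1 times a common factor.
  term-step-suc : ∀ r d → term (suc r) (suc d) ⊕ gap (suc r) d ⊕ gap r (suc d) ≗ term (suc r) d
  term-step-suc r d = begin
    term (suc r) (suc d) ⊕ gap (suc r) d ⊕ gap r (suc d)
      ≈⟨ PS.+-cong (PS.+-congˡ {term (suc r) (suc d)} (gap-rise (suc r) d))
         (PS.*-congʳ {e} (tailProduct-front r d)) ⟩
    Q · (q^ 0 ⊝ y) · e′ ⊕ Q · (y · e′) ⊕ (q^ 0 ⊝ z) · Q · e
      ≈⟨ PS.+-congʳ {(q^ 0 ⊝ z) · Q · e}
         (PS.+-cong (PS.*-congˡ {Q · (q^ 0 ⊝ y)} e′≗z·e) (PS.*-congˡ {Q} (PS.*-congˡ {y} e′≗z·e))) ⟩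
    Q · (q^ 0 ⊝ y) · (z · e) ⊕ Q · (y · (z · e)) ⊕ (q^ 0 ⊝ z) · Q · e
      ≈⟨ identity Q y z e ⟩
    Q · e
      ≡⟨ cong (λ m → Q · q^ m) (Exponents.same k r d (triangular r)) ⟨
    term (suc r) d ∎
    where
    Q = tailProduct (suc r) d
    y = q^ (k ℕ.* (suc r ℕ.+ suc d))
    z = q^ (k ℕ.* suc r)
    e′ = q^ (k ℕ.* (suc r ℕ.* (suc r ℕ.+ suc d) ℕ.+ triangular (suc r)))
    e = q^ (k ℕ.* (suc r ℕ.* suc (r ℕ.+ suc d) ℕ.+ triangular r))
    e′≗z·e : e′ ≗ z · e
    e′≗z·e = PS.trans (PS.reflexive (cong q^_ (Exponents.split k r d (triangular r))))
                      (q^-+ (k ℕ.* suc r) _)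
    identity : ∀ Q y z e →
      Q · (q^ 0 ⊝ y) · (z · e) ⊕ Q · (y · (z · e)) ⊕ (q^ 0 ⊝ z) · Q · e ≗ Q · e
    identity = solve 4 (λ Q y z e → Q :* (con 1ℤ :- y) :* (z :* e) :+ Q :* (y :* (z :* e))
      :+ (con 1ℤ :- z) :* Q :* e := Q :* e) (λ _ → refl)

  -- (-1)^m ∑_{0 ≤ s ≤ m} (-1)^s term s (n - s) for n = m + d; this
  -- normalisation keeps explicit signs out of the recursion.
  alternating : ℕ → ℕ → PowerSeries
  alternating zero    d = term 0 d
  alternating (suc m) d = term (suc m) d ⊝ alternating m (suc d)

  -- Each gap enters two neighbouring terms, whose signs are opposite; only the gap at the last
  -- index survives.
  alternating-step : ∀ m d → alternating m (suc d) ⊕ gap m d ≗ alternating m d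
  alternating-step zero    d = term-step-0 d
  alternating-step (suc m) d = begin
    term (suc m) (suc d) ⊝ B₂ ⊕ gap (suc m) d
      ≈⟨ regroup (term (suc m) (suc d)) B₂ (gap (suc m) d) (gap m (suc d)) ⟩
    term (suc m) (suc d) ⊕ gap (suc m) d ⊕ gap m (suc d) ⊝ (B₂ ⊕ gap m (suc d))
      ≈⟨ PS.+-cong (term-step-suc m d) (PS.-‿cong (alternating-step m (suc d))) ⟩
    term (suc m) d ⊝ alternating m (suc d) ∎
    where
    B₂ = alternating m (suc (suc d))
    regroup : ∀ a b c e → a ⊝ b ⊕ c ≗ a ⊕ c ⊕ e ⊝ (b ⊕ e)
    regroup = solve 4 (λ a b c e → a :- b :+ c := a :+ c :+ e :- (b :+ e)) (λ _ → refl)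

  -- Both new contributions have an empty tail product, so they are monomials, with exponents k s(3s
  -- + 1)/2 and k s(3s - 1)/2 for s = n + 1.
  alternating-suc : ∀ n → alternating (suc n) 0 ≗ term (suc n) 0 ⊕ gap n 0 ⊝ alternating n 0
  alternating-suc n = begin
    term (suc n) 0 ⊝ alternating n 1
      ≈⟨ regroup (term (suc n) 0) (alternating n 1) (gap n 0) ⟩
    term (suc n) 0 ⊕ gap n 0 ⊝ (alternating n 1 ⊕ gap n 0)
      ≈⟨ PS.+-congˡ {term (suc n) 0 ⊕ gap n 0} (PS.-‿cong (alternating-step n 0)) ⟩
    term (suc n) 0 ⊕ gap n 0 ⊝ alternating n 0 ∎
    where
    regroup : ∀ a b c → a ⊝ b ≗ a ⊕ c ⊝ (b ⊕ c)
    regroup = solve 3 (λ a b c → a :- b := a :+ c :- (b :+ c)) (λ _ → refl)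

  -- The two families are k times n(3n + 1)/2 and k times m(3m - 1)/2 with m = n + 1: together, the
  -- generalised pentagonal numbers.
  OffPentagonal : ℕ → Set
  OffPentagonal N = (∀ n → k ℕ.* (n ℕ.* n ℕ.+ triangular n) ≢ N)
                  × (∀ n → k ℕ.* (suc n ℕ.* suc n ℕ.+ triangular n) ≢ N)

  1·q^-off : ∀ {m n N} → n ≡ m → k ℕ.* m ≢ N → (q^ 0 · q^ (k ℕ.* n)) N ≡ 0ℤ
  1·q^-off {m} {N = N} refl m≢N = trans (·-identityˡ (q^ (k ℕ.* m)) N) (q^-≢ m≢N)

  alternating-off : ∀ {N} → OffPentagonal N → ∀ n → alternating n 0 N ≡ 0ℤ
  alternating-off off zero    = 1·q^-off refl (proj₁ off 0)
  alternating-off {N} off (suc n) = trans (alternating-suc n N)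
    (cong₂ _-_ (cong₂ _+_
        (1·q^-off (cong (λ m → suc n ℕ.* m ℕ.+ triangular (suc n)) (ℕ.+-identityʳ (suc n)))
          (proj₁ off (suc n)))
        (1·q^-off (cong (λ m → suc n ℕ.* suc m ℕ.+ triangular n) (ℕ.+-identityʳ n))
           (proj₂ off n)))
      (alternating-off off n))

  -- The terms s = m, ..., 1 are discarded one by one with m + d fixed, each starting beyond degree
  -- N; what remains is `term 0`, the partial product.
  alternating⇒qProduct : .{{_ : ℕ.NonZero k}} → ∀ {N} m d → N ℕ.≤ m ℕ.+ d →
                         alternating m d N ≡ 0ℤ → qProduct k (m ℕ.+ d) N ≡ 0ℤ
  alternating⇒qProduct {N} zero d _ ≡0 = trans
    -- The exponent in `term 0 d` is `k ℕ.* 0`, which does not reduce for a variable `k`.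
    (sym (trans (cong (λ m → term′ m N) (ℕ.*-zeroʳ k))
      (trans (·-comm (tailProduct 0 d) (q^ 0) N)
      (trans (·-identityˡ (tailProduct 0 d) N) (cong (λ a → a N) (tailProduct-0 d)))))) ≡0
    where
    term′ : ℕ → PowerSeries
    term′ m = tailProduct 0 d · q^ m
  alternating⇒qProduct {N} (suc m) d N≤ ≡0 =
    subst (λ l → qProduct k l N ≡ 0ℤ) (ℕ.+-suc m d)
      (alternating⇒qProduct m (suc d) (subst (N ℕ.≤_) (sym (ℕ.+-suc m d)) N≤)
        (trans (cancel (term (suc m) d N) _ (·-q^-off (tailProduct (suc m) d) N<)) (cong -_ ≡0)))
    where
    cancel : ∀ x y → x ≡ 0ℤ → y ≡ - (x - y)
    cancel x y refl = lemma y
      where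
      lemma : ∀ y → y ≡ - (0ℤ - y)
      lemma = solve-∀
    e = suc m ℕ.* (suc m ℕ.+ d) ℕ.+ triangular (suc m)
    N< : N ℕ.< k ℕ.* e
    N< = ℕ.≤-<-trans N≤ (ℕ.<-≤-trans (Exponents.large m d) (ℕ.m≤n*m e k))

  f-off : .{{_ : ℕ.NonZero k}} → ∀ {N} → OffPentagonal N → f k N ≡ 0ℤ
  f-off {N} off = subst (λ l → qProduct k l N ≡ 0ℤ) (ℕ.+-identityʳ N)
    (alternating⇒qProduct N 0 (ℕ.m≤m+n N 0) (alternating-off off N))

-- Reduction modulo 2.

-- Factor by factor, (1 - y)² = (1 - y²) + 2(y² - y). The congruence is carried by an explicit
-- series `c` so that it can be used in ring identities.
qProduct-² : ∀ k N → ∃ λ c → qProduct k N ² ≗ qProduct (2 ℕ.* k) N ⊕ (c ⊕ c)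
qProduct-² k zero    = const 0ℤ , solve 0 (con 1ℤ :* con 1ℤ := con 1ℤ :+ (con 0ℤ :+ con 0ℤ)) (λ _ → refl)
qProduct-² k (suc N) = let c , P²≗R+2c = qProduct-² k N in
  c · (q^ 0 ⊝ y) · (q^ 0 ⊝ y) ⊕ R · (y · y ⊝ y) , (begin
    P · (q^ 0 ⊝ y) · (P · (q^ 0 ⊝ y))
      ≈⟨ gather P y ⟩
    P · P · ((q^ 0 ⊝ y) · (q^ 0 ⊝ y))
      ≈⟨ PS.*-congʳ {(q^ 0 ⊝ y) · (q^ 0 ⊝ y)} P²≗R+2c ⟩
    (R ⊕ (c ⊕ c)) · ((q^ 0 ⊝ y) · (q^ 0 ⊝ y))
      ≈⟨ expand R c y ⟩
    R · (q^ 0 ⊝ y · y) ⊕ (c′ c ⊕ c′ c)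
      ≈⟨ PS.+-congʳ {c′ c ⊕ c′ c} (PS.*-congˡ {R} (PS.+-congˡ {q^ 0} (PS.-‿cong z≗y·y))) ⟨
    R · (q^ 0 ⊝ q^ (2 ℕ.* k ℕ.* suc N)) ⊕ (c′ c ⊕ c′ c) ∎)
  where
  open SetoidReasoning PS.setoid
  P = qProduct k N
  R = qProduct (2 ℕ.* k) N
  y = q^ (k ℕ.* suc N)
  c′ : PowerSeries → PowerSeries
  c′ c = c · (q^ 0 ⊝ y) · (q^ 0 ⊝ y) ⊕ R · (y · y ⊝ y)
  z≗y·y : q^ (2 ℕ.* k ℕ.* suc N) ≗ y · y
  z≗y·y = PS.trans (PS.reflexive (cong q^_ (double k (suc N)))) (q^-+ (k ℕ.* suc N) (k ℕ.* suc N))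
    where
    double : ∀ k m → 2 ℕ.* k ℕ.* m ≡ k ℕ.* m ℕ.+ k ℕ.* m
    double = solveℕ-∀
  gather : ∀ P y → P · (q^ 0 ⊝ y) · (P · (q^ 0 ⊝ y)) ≗ P · P · ((q^ 0 ⊝ y) · (q^ 0 ⊝ y))
  gather = solve 2 (λ P y → P :* (con 1ℤ :- y) :* (P :* (con 1ℤ :- y))
    := P :* P :* ((con 1ℤ :- y) :* (con 1ℤ :- y))) (λ _ → refl)
  expand : ∀ R c y → (R ⊕ (c ⊕ c)) · ((q^ 0 ⊝ y) · (q^ 0 ⊝ y)) ≗
    R · (q^ 0 ⊝ y · y) ⊕ ((c · (q^ 0 ⊝ y) · (q^ 0 ⊝ y) ⊕ R · (y · y ⊝ y))
                        ⊕ (c · (q^ 0 ⊝ y) · (q^ 0 ⊝ y) ⊕ R · (y · y ⊝ y)))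
  expand = solve 3 (λ R c y → (R :+ (c :+ c)) :* ((con 1ℤ :- y) :* (con 1ℤ :- y)) :=
    R :* (con 1ℤ :- y :* y) :+ ((c :* (con 1ℤ :- y) :* (con 1ℤ :- y) :+ R :* (y :* y :- y))
                        :+ (c :* (con 1ℤ :- y) :* (con 1ℤ :- y) :+ R :* (y :* y :- y)))) (λ _ → refl)

f-² : ∀ k .{{_ : ℕ.NonZero k}} → ∃ λ c → f k ² ≗ f (2 ℕ.* k) ⊕ (c ⊕ c)
-- The witness is diagonal: its n-th coefficient comes from the n-th partial product, which already
-- determines both sides in degree n.
f-² k = (λ n → proj₁ (qProduct-² k n) n) , λ n →
  trans (·-cong-≤ n (stable n) (stable n)) (proj₂ (qProduct-² k n) n)
  where
  stable : ∀ n m → m ℕ.≤ n → f k m ≡ qProduct k n m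
  stable n m m≤n = sym (subst (λ l → qProduct k l m ≡ f k m) (ℕ.m∸n+n≡m m≤n)
    (qProduct-stable k m (n ∸ m)))

-- With f₂² = F + 2c, the defining relation reads EOᵤ (F + 2c) = F². Multiplying by the inverse u of
-- F = f₄ gives EOᵤ = F - 2 EOᵤ c u.
EOᵤ≡f₄-mod-2 : ∃ λ c → EOᵤ ≗ f 4 ⊕ (c ⊕ c)
EOᵤ≡f₄-mod-2 = ⊖ (EOᵤ · c · u) , (begin
  EOᵤ
    ≈⟨ ·-identityˡ EOᵤ ⟨
  q^ 0 · EOᵤ
    ≈⟨ PS.*-congʳ {EOᵤ} uF≗1 ⟨
  u · F · EOᵤ
    ≈⟨ introduce EOᵤ F c u ⟩
  u · (EOᵤ · (F ⊕ (c ⊕ c))) ⊕ (⊖ (EOᵤ · c · u) ⊕ ⊖ (EOᵤ · c · u))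
    ≈⟨ PS.+-congʳ {⊖ (EOᵤ · c · u) ⊕ ⊖ (EOᵤ · c · u)} (PS.trans
         (PS.*-congˡ {u} (PS.trans (PS.*-congˡ {EOᵤ} (PS.sym (proj₂ (f-² 2)))) EOᵤ-spec))
         (PS.trans (PS.sym (·-assoc u F F)) (PS.trans (PS.*-congʳ {F} uF≗1) (·-identityˡ F)))) ⟩
  F ⊕ (⊖ (EOᵤ · c · u) ⊕ ⊖ (EOᵤ · c · u)) ∎)
  where
  open SetoidReasoning PS.setoid
  F = f 4
  u = q^ 0 ÷ F
  c = proj₁ (f-² 2)
  uF≗1 : u · F ≗ q^ 0
  uF≗1 = ÷-· (q^ 0) F refl
  introduce : ∀ a F c u → u · F · a ≗
    u · (a · (F ⊕ (c ⊕ c))) ⊕ (⊖ (a · c · u) ⊕ ⊖ (a · c · u))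
  introduce = solve 4 (λ a F c u → u :* F :* a :=
    u :* (a :* (F :+ (c :+ c))) :+ ((:- (a :* c :* u)) :+ (:- (a :* c :* u)))) (λ _ → refl)

EOᵤ-even : ∀ {N} → f 4 N ≡ 0ℤ → EOᵤ N ≡ 0ℤ [mod + 2 ]
EOᵤ-even {N} f≡0 = divides (c N) (begin
  EOᵤ N - 0ℤ               ≡⟨ cong (_- 0ℤ) (trans (EOᵤ≗ N) (cong (λ x → x + (c N + c N)) f≡0)) ⟩
  0ℤ + (c N + c N) - 0ℤ    ≡⟨ lemma (c N) ⟩
  c N * + 2                ∎)
  where
  open ≡-Reasoning
  c = proj₁ EOᵤ≡f₄-mod-2
  EOᵤ≗ = proj₂ EOᵤ≡f₄-mod-2
  lemma : ∀ x → 0ℤ + (x + x) - 0ℤ ≡ x * + 2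
  lemma = solve-∀

-- Residues of the quadratic polynomial modulo p.

-- The remainder equals the difference of the two quotients times `d`; being less than `d`, it
-- forces that difference to be zero.
/-unique : ∀ {a} b d .{{_ : ℕ.NonZero d}} → a ≡ b * + d → a /ℕ d ≡ b
/-unique {a} b d a≡bd with ∣ b - a /ℕ d ∣ in eq | abs≡
  where
  abs≡ : ∣ b - a /ℕ d ∣ ℕ.* d ≡ a %ℕ d
  abs≡ = trans (sym (ℤ.abs-* (b - a /ℕ d) (+ d))) (cong ∣_∣ (begin
    (b - a /ℕ d) * + d                              ≡⟨ lemma b (a /ℕ d) (+ d) ⟩
    b * + d - a /ℕ d * + d                          ≡⟨ cong (_- a /ℕ d * + d) (trans (sym a≡bd) (a≡a%ℕn+[a/ℕn]*n a d)) ⟩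
    + (a %ℕ d) + a /ℕ d * + d - a /ℕ d * + d        ≡⟨ cancel (+ (a %ℕ d)) (a /ℕ d * + d) ⟩
    + (a %ℕ d)                                      ∎))
    where
    open ≡-Reasoning
    lemma : ∀ x y z → (x - y) * z ≡ x * z - y * z
    lemma = solve-∀
    cancel : ∀ x y → x + y - y ≡ x
    cancel = solve-∀
... | zero  | _   = sym (ℤ.i-j≡0⇒i≡j b (a /ℕ d) (ℤ.∣i∣≡0⇒i≡0 eq))
... | suc m | eq′ = contradiction (ℕ.≤-trans (ℕ.m≤m+n d (m ℕ.* d)) (ℕ.≤-reflexive eq′))
                                  (ℕ.<⇒≱ (n%ℕd<d a d))

≡-mod-shift : ∀ {m} a {b c} → a ≡ b [mod m ] → m ∣ b - c → a ≡ c [mod m ]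
≡-mod-shift {m} a {b} {c} m∣a-b m∣b-c = subst (m ∣_) (lemma a b c) (∣m∣n⇒∣m+n m∣a-b m∣b-c)
  where
  lemma : ∀ a b c → (a - b) + (b - c) ≡ a - c
  lemma = solve-∀

module Residues (g : ℕ) (ε : ℤ) (p : ℕ) (p≡6g+ε : + p ≡ + 6 * + g + ε) where

  φ : ℤ → ℤ
  φ k = (k - + g) * (+ 3 * k - + 3 * + g - ε)

  φ-diff : ∀ k l → φ k - φ l ≡ (k - l) * (+ 3 * (k + l) - + p)
  φ-diff k l = trans (lemma (+ g) ε k l) (cong (λ x → (k - l) * (+ 3 * (k + l) - x)) (sym p≡6g+ε))
    where
    lemma : ∀ g ε k l → (k - g) * (+ 3 * k - + 3 * g - ε) - (l - g) * (+ 3 * l - + 3 * g - ε)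
                      ≡ (k - l) * (+ 3 * (k + l) - (+ 6 * g + ε))
    lemma = solve-∀

  φ-cong : ∀ k l → + p ∣ k - l → + p ∣ φ k - φ l
  φ-cong k l p∣ = subst (+ p ∣_) (sym (φ-diff k l)) (∣m⇒∣m*n _ p∣)

  φ-reflect : ∀ k l → + p ∣ k + l → + p ∣ φ k - φ l
  φ-reflect k l p∣ = subst (+ p ∣_) (sym (φ-diff k l))
    (∣n⇒∣m*n (k - l) (∣m∣n⇒∣m-n (∣n⇒∣m*n (+ 3) p∣) ∣-refl))

  -- Writing 1 as ε², (6g + ε)² - ε² = 12 g(3g + ε), so the division by 12 is exact.
  φ-0 : ε * ε ≡ 1ℤ → ((+ p) ^ 2 - 1ℤ) / + 12 ≡ φ 0ℤ
  φ-0 ε²≡1 = trans (div-pos-is-/ℕ ((+ p) ^ 2 - 1ℤ) 12) (/-unique (φ 0ℤ) 12 (begin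
    (+ p) ^ 2 - 1ℤ                 ≡⟨ cong₂ (λ x y → x ^ 2 - y) p≡6g+ε (sym ε²≡1) ⟩
    (+ 6 * + g + ε) ^ 2 - ε * ε    ≡⟨ lemma (+ g) ε ⟩
    φ 0ℤ * + 12                    ∎))
    where
    open ≡-Reasoning
    -- The square is unfolded because the ring solver does not accept _^_.
    lemma : ∀ g ε → (+ 6 * g + ε) * ((+ 6 * g + ε) * 1ℤ) - ε * ε ≡
            (0ℤ - g) * (+ 3 * 0ℤ - + 3 * g - ε) * + 12
    lemma = solve-∀

  module _ .{{_ : ℕ.NonZero p}} (h : ℤ) (p≡1+2h : + p ≡ 1ℤ + h * + 2) (a : ℤ)
           (a≢φ0 : ¬ a ≡ φ 0ℤ [mod + p ])
           (a≢φ : ∀ k → 1ℤ ≤ k → k ≤ h → ¬ a ≡ φ k [mod + p ]) where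

    -- Here h is (p - 1)/2. A residue above h is reflected to l = p - r, which lies between 1 and h
    -- and has the same value of φ modulo p.
    avoids-residue : ∀ r → r ℕ.< p → ¬ a ≡ φ (+ r) [mod + p ]
    avoids-residue zero    r<p = a≢φ0
    avoids-residue (suc r) r<p a≡φr with + suc r ℤ.≤? h
    ... | yes r≤h = a≢φ (+ suc r) (+≤+ (s≤s z≤n)) r≤h a≡φr
    ... | no  r≰h = a≢φ l 1≤l l≤h (≡-mod-shift a a≡φr
                      (φ-reflect (+ suc r) l (∣-reflexive (sym (lemma (+ suc r) (+ p))))))
      where
      l = + p - + suc r
      lemma : ∀ x y → x + (y - x) ≡ y
      lemma = solve-∀
      1≤l : 1ℤ ≤ l
      1≤l = ℤ.0≤i-j⇒j≤i (subst (0ℤ ≤_) (swap (+ p) (+ suc r)) (ℤ.i≤j⇒0≤j-i (+≤+ r<p)))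
        where
        swap : ∀ x y → x - (1ℤ + y) ≡ x - y - 1ℤ
        swap = solve-∀
      -- From r ≥ h + 1 and p = 1 + 2h.
      l≤h : l ≤ h
      l≤h = ℤ.0≤i-j⇒j≤i (subst (0ℤ ≤_)
        (trans (swap (+ suc r) h) (cong (λ x → h - (x - + suc r)) (sym p≡1+2h)))
        (ℤ.i≤j⇒0≤j-i (ℤ.i<j⇒suc[i]≤j (ℤ.≰⇒> r≰h))))
        where
        swap : ∀ r h → r - (1ℤ + h) ≡ h - (1ℤ + h * + 2 - r)
        swap = solve-∀

    avoids : ∀ k → ¬ a ≡ φ k [mod + p ]
    avoids k a≡φk = avoids-residue (k %ℕ p) (n%ℕd<d k p) (≡-mod-shift a a≡φk
      (φ-cong k (+ (k %ℕ p)) (divides (k /ℕ p) (trans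
        (cong (_- + (k %ℕ p)) (a≡a%ℕn+[a/ℕn]*n k p)) (cancel (+ (k %ℕ p)) (k /ℕ p * + p))))))
      where
      cancel : ∀ x y → x + y - x ≡ y
      cancel = solve-∀

    avoids-pentagonal : ε * ε ≡ 1ℤ → ∀ n m → + p * n + a ≢ m * (+ 3 * m - 1ℤ)
    -- For k = εm + g the factors of φ(k) are εm and ε(3m - 1), and ε² = 1; the quotient -n is what
    -- is left of a - (pn + a).
    avoids-pentagonal ε²≡1 n m eq = avoids (ε * m + + g) (divides (- n) (begin
      a - φ (ε * m + + g)
        ≡⟨ cong (λ x → a - x) (expand ε m (+ g)) ⟩
      a - ε * ε * (m * (+ 3 * m - 1ℤ))
        ≡⟨ cong₂ (λ x y → a - x * y) ε²≡1 (sym eq) ⟩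
      a - 1ℤ * (+ p * n + a)
        ≡⟨ cancel a (+ p) n ⟩
      - n * + p ∎))
      where
      open ≡-Reasoning
      expand : ∀ ε m g → (ε * m + g - g) * (+ 3 * (ε * m + g) - + 3 * g - ε)
                         ≡ ε * ε * (m * (+ 3 * m - 1ℤ))
      expand = solve-∀
      cancel : ∀ a p n → a - 1ℤ * (p * n + a) ≡ - n * p
      cancel = solve-∀

-- Pentagonal exponents of f₄.

triangular-closed : ∀ n → 2 ℕ.* triangular n ≡ n ℕ.* suc n
triangular-closed zero    = refl
triangular-closed (suc n) = begin
  2 ℕ.* (triangular n ℕ.+ suc n)        ≡⟨ ℕ.*-distribˡ-+ 2 (triangular n) (suc n) ⟩
  2 ℕ.* triangular n ℕ.+ 2 ℕ.* suc n    ≡⟨ cong (ℕ._+ 2 ℕ.* suc n) (triangular-closed n) ⟩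
  n ℕ.* suc n ℕ.+ 2 ℕ.* suc n           ≡⟨ lemma n ⟩
  suc n ℕ.* suc (suc n)                 ∎
  where
  open ≡-Reasoning
  lemma : ∀ n → n ℕ.* suc n ℕ.+ 2 ℕ.* suc n ≡ suc n ℕ.* suc (suc n)
  lemma = solveℕ-∀

-- Here `s` stands for the square in either pentagonal family; doubling the triangular number
-- removes its denominator.
halve : ∀ s n {N} → 4 ℕ.* (s ℕ.+ triangular n) ≡ 2 ℕ.* N → N ≡ s ℕ.+ s ℕ.+ n ℕ.* suc n
halve s n {N} eq = ℕ.*-cancelˡ-≡ N _ 2 (begin
  2 ℕ.* N                                        ≡⟨ eq ⟨
  4 ℕ.* (s ℕ.+ triangular n)                     ≡⟨ lemma s (triangular n) ⟩
  2 ℕ.* (s ℕ.+ s ℕ.+ 2 ℕ.* triangular n)         ≡⟨ cong (λ x → 2 ℕ.* (s ℕ.+ s ℕ.+ x)) (triangular-closed n) ⟩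
  2 ℕ.* (s ℕ.+ s ℕ.+ n ℕ.* suc n)                ∎)
  where
  open ≡-Reasoning
  lemma : ∀ s t → 4 ℕ.* (s ℕ.+ t) ≡ 2 ℕ.* (s ℕ.+ s ℕ.+ 2 ℕ.* t)
  lemma = solveℕ-∀

f₄-off : ∀ {N} → (∀ m → + N ≢ m * (+ 3 * m - 1ℤ)) → f 4 (2 ℕ.* N) ≡ 0ℤ
f₄-off {N} N≢ = Shanks.f-off 4
  -- The family n(3n + 1) is m(3m - 1) at m = -n; the other family is the same expression at m = n +
  -- 1.
  ( (λ n eq → N≢ (- + n) (begin
      + N                                      ≡⟨ cong +_ (halve (n ℕ.* n) n eq) ⟩
      + (n ℕ.* n ℕ.+ n ℕ.* n ℕ.+ n ℕ.* suc n)  ≡⟨ cong₂ (λ x y → x + x + y) (ℤ.pos-* n n) (ℤ.pos-* n (suc n)) ⟩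
      + n * + n + + n * + n + + n * + suc n    ≡⟨ left (+ n) ⟩
      - + n * (+ 3 * - + n - 1ℤ)               ∎))
  , (λ n eq → N≢ (+ suc n) (begin
      + N                                      ≡⟨ cong +_ (halve (suc n ℕ.* suc n) n eq) ⟩
      + (suc n ℕ.* suc n ℕ.+ suc n ℕ.* suc n ℕ.+ n ℕ.* suc n)
                                               ≡⟨ cong₂ (λ x y → x + x + y) (ℤ.pos-* (suc n) (suc n)) (ℤ.pos-* n (suc n)) ⟩
      + suc n * + suc n + + suc n * + suc n + + n * + suc n
                                               ≡⟨ right (+ n) ⟩
      + suc n * (+ 3 * + suc n - 1ℤ)           ∎)) )
  where
  open ≡-Reasoning
  left : ∀ x → x * x + x * x + x * (1ℤ + x) ≡ - x * (+ 3 * - x - 1ℤ)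
  left = solve-∀
  right : ∀ x → (1ℤ + x) * (1ℤ + x) + (1ℤ + x) * (1ℤ + x) + x * (1ℤ + x)
                ≡ (1ℤ + x) * (+ 3 * (1ℤ + x) - 1ℤ)
  right = solve-∀

-- The congruence for EOᵤ.

-- Oddness of ε in the form that makes (p - 1)/2 equal to 3g + e.
ε-half : ∀ {ε} → ε ≡ 1ℤ ⊎ ε ≡ -1ℤ → ∃ λ e → ε ≡ 1ℤ + e * + 2
ε-half (inj₁ refl) = 0ℤ , refl
ε-half (inj₂ refl) = -1ℤ , refl

ε² : ∀ {ε} → ε ≡ 1ℤ ⊎ ε ≡ -1ℤ → ε * ε ≡ 1ℤ
ε² (inj₁ refl) = refl
ε² (inj₂ refl) = refl

theorem3p2 : (g : ℕ) → 1 ℕ.≤ g →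
    (ε : ℤ) → ε ≡ 1ℤ ⊎ ε ≡ -1ℤ →
    (p : ℕ) → + p ≡ + 6 * + g + ε →
    (i : ℕ) → + i ≤ + p - 1ℤ →
    ¬ (+ i ≡ ((+ p) ^ 2 - 1ℤ) / + 12 [mod + p ]) →
    ((k : ℤ) → 1ℤ ≤ k → k ≤ (+ p - 1ℤ) / + 2 →
    ¬ (+ i ≡ (k - + g) * (+ 3 * k - + 3 * + g - ε) [mod + p ])) →
    (n : ℕ) → EOᵤ (2 ℕ.* p ℕ.* n ℕ.+ 2 ℕ.* i) ≡ 0ℤ [mod + 2 ]
-- For p = 0 the bound on `i` would read i ≤ -1. In the other clause the successor pattern supplies
-- `NonZero p`.
theorem3p2 g _ ε ε≡±1 zero _ i () _ _ n
theorem3p2 g _ ε ε≡±1 p@(suc _) p≡6g+ε i _ i≢φ0 i≢φ n =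
  EOᵤ-even {2 ℕ.* p ℕ.* n ℕ.+ 2 ℕ.* i} (subst (λ N → f 4 N ≡ 0ℤ) (double p n i) (f₄-off λ m eq →
    avoids-pentagonal h p≡1+2h (+ i)
      (subst (λ x → ¬ + i ≡ x [mod + p ]) (φ-0 (ε² ε≡±1)) i≢φ0)
      (λ k 1≤k k≤h → i≢φ k 1≤k (subst (k ≤_) (sym half≡h) k≤h))
      (ε² ε≡±1) (+ n) m (trans (cong (_+ + i) (sym (ℤ.pos-* p n))) eq)))
  where
  open Residues g ε p p≡6g+ε
  e = proj₁ (ε-half ε≡±1)
  h = + 3 * + g + e
  p≡1+2h : + p ≡ 1ℤ + h * + 2
  p≡1+2h = trans p≡6g+ε (trans (cong (λ x → + 6 * + g + x) (proj₂ (ε-half ε≡±1))) (lemma (+ g) e))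
    where
    lemma : ∀ g e → + 6 * g + (1ℤ + e * + 2) ≡ 1ℤ + (+ 3 * g + e) * + 2
    lemma = solve-∀
  half≡h : (+ p - 1ℤ) / + 2 ≡ h
  half≡h = trans (div-pos-is-/ℕ (+ p - 1ℤ) 2)
    (/-unique h 2 (trans (cong (_- 1ℤ) p≡1+2h) (lemma (h * + 2))))
    where
    lemma : ∀ x → 1ℤ + x - 1ℤ ≡ x
    lemma = solve-∀
  double : ∀ p n i → 2 ℕ.* (p ℕ.* n ℕ.+ i) ≡ 2 ℕ.* p ℕ.* n ℕ.+ 2 ℕ.* i
  double = solveℕ-∀
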